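{- Let $G$ be a daisy cube properly embedded into $Q_n$. For $i\in\{1,\ldots,n\}$ let $E_i$ be the set of edges of $G$ using the direction $i$, so that $|E_i|$ is the number of such edges. Then the Wiener index $W(G)$ and the Mostar index $\mathit{Mo}(G)$ of $G$ are $$W(G)=|V(G)|\,|E(G)|-\sum_{i=1}^n |E_i|^2$$ and $$\mathit{Mo}(G)=|V(G)|\,|E(G)|-2\sum_{i=1}^n |E_i|^2.$$
   Context: Let $B=\{0,1\}$; elements of $B^n$ are written as binary strings $u=u_1\ldots u_n$. The hypercube $Q_n$ has vertex set $B^n$, two vertices being adjacent iff they differ in precisely one coordinate. An edge $uv$ of $Q_n$ uses the direction $i$ if $u$ and $v$ differ in coordinate $i$. The distance $d(u,v)$ between two vertices of a connected graph is the number of edges on a shortest $u,v$-path. A subgraph $G$ of a graph $H$ is isometric if the distance in $G$ between any two vertices of $G$ equals their distance in $H$. Let $\le$ be the partial order on $B^n$ with $u\le v$ iff $u_i\le v_i$ for all $i\in\{1,\ldots,n\}$. For $X\subseteq B^n$, the daisy cube generated by $X$ is $Q_n(X)$, the subgraph of $Q_n$ induced by $\{u\in B^n : u\le x \text{ for some } x\in X\}$. A graph $G$ is a daisy cube if there exist an isometric embedding of $G$ in some hypercube $Q_n$ and a subset $X\subseteq B^n$ such that (the image of) $G$ is the daisy cube $Q_n(X)$; such an embedding is called a proper embedding, and $G$ is then identified with its image. The Wiener index of a connected graph $G$ is $W(G)=\sum_{\{u,v\}\subset V(G)}d(u,v)$, the sum being over unordered pairs of vertices. For an edge $uv\in E(G)$,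 $n_{u,v}$ denotes the number of vertices of $G$ that are (strictly) closer to $u$ than to $v$. The Mostar index is $\mathit{Mo}(G)=\sum_{uv\in E(G)}|n_{u,v}-n_{v,u}|$, the sum being over the edges of $G$. -}

module Defs where

open import Level using (0ℓ)
open import Data.Bool.Base as Bool using (Bool)
import Data.Bool.Properties as Bool
open import Data.Fin.Base using (Fin)
open import Data.List.Base using (List; []; _∷_; _++_; map; filter; length; sum)
open import Data.List.Membership.Propositional using (_∈_; find; lose)
open import Data.List.Relation.Unary.Any using (any?)
open import Data.List.Relation.Unary.Unique.Propositional using (Unique)
open import Data.Nat.Base using (ℕ; zero; suc; _≤_; z≤n; s≤s; ∣_-_∣)
open import Data.Nat.Properties using (_<?_)
open import Data.Product using (_×_; _,_; proj₁; proj₂; ∃-syntax; ∃!; uncurry)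
open import Data.Vec.Base using (Vec; lookup)
open import Data.Vec.Relation.Binary.Pointwise.Inductive using (Pointwise)
open import Function.Bundles using (_⇔_)
open import Function.Definitions using (Injective)
open import Relation.Binary.Core using (Rel)
open import Relation.Binary.Definitions using (Decidable; DecidableEquality; Symmetric)
open import Relation.Binary.PropositionalEquality using (_≡_; _≢_; refl; sym)
open import Relation.Nullary using (¬_; Dec; yes; no; contradiction)
open import Relation.Nullary.Decidable using (¬?; map′)
open import Relation.Unary using (Pred)

record Graph : Set₁ where
  infix 4 _~_
  field
    Vertex  : Set
    _~_     : Rel Vertex 0ℓ
    ~-sym   : Symmetric _~_
    ~-irrefl : ∀ {u} → ¬ (u ~ u)

record Finite (G : Graph) : Set where
  open Graph G
  field
    vertices : List Vertex
    unique   : Unique vertices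
    complete : ∀ v → v ∈ vertices
    _≟_      : DecidableEquality Vertex
    _~?_     : Decidable _~_

module _ (G : Graph) where
  open Graph G

  data Walk : Vertex → Vertex → ℕ → Set where
    []  : ∀ {u} → Walk u u 0
    _∷_ : ∀ {u v w k} → u ~ v → Walk v w k → Walk u w (suc k)

  Connected : Set
  Connected = ∀ u v → ∃[ k ] Walk u v k

  -- A shortest walk is a path, so minimising over walks or over paths
  -- gives the same number.
  IsDistance : Vertex → Vertex → ℕ → Set
  IsDistance u v k = Walk u v k × (∀ {j} → Walk u v j → k ≤ j)

least : {P : Pred ℕ 0ℓ} → (∀ k → Dec (P k)) → ∀ k → P k →
        ∃[ m ] P m × (∀ {j} → P j → m ≤ j)
least P? k pk with P? 0
least P? k pk          | yes p0 = 0 , p0 , λ _ → z≤n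
least P? zero pk       | no ¬p0 = contradiction pk ¬p0
least {P} P? (suc k) pk | no ¬p0 with least (λ j → P? (suc j)) k pk
... | m , pm , min = suc m , pm , λ { {zero} p0 → contradiction p0 ¬p0
                                    ; {suc j} pj → s≤s (min pj) }

-- The pairs of entries at positions i < j: for a list without repetitions,
-- each unordered pair of distinct members exactly once.
pairs : {A : Set} → List A → List (A × A)
pairs []       = []
pairs (x ∷ xs) = map (x ,_) xs ++ pairs xs

module _ {G : Graph} (fin : Finite G) where
  open Graph G
  open Finite fin

  walk? : ∀ k u v → Dec (Walk G u v k)
  walk? zero u v = map′ (λ { refl → [] }) (λ { [] → refl }) (u ≟ v)
  walk? (suc k) u v with any? (λ w → step? w) vertices
    where
    step? : ∀ w → Dec (u ~ w × Walk G w v k)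
    step? w with u ~? w | walk? k w v
    ... | yes e | yes p = yes (e , p)
    ... | no ¬e | _     = no λ s → ¬e (proj₁ s)
    ... | yes _ | no ¬p = no λ s → ¬p (proj₂ s)
  ... | yes some = let _ , _ , e , p = find some in yes (e ∷ p)
  ... | no none  = no λ { (e ∷ p) → none (lose (complete _) (e , p)) }

  edges : List (Vertex × Vertex)
  edges = filter (uncurry _~?_) (pairs vertices)

  ∣V∣ : ℕ
  ∣V∣ = length vertices

  ∣E∣ : ℕ
  ∣E∣ = length edges

  module _ (conn : Connected G) where

    distance : ∀ u v → ∃[ k ] IsDistance G u v k
    distance u v = let k , p = conn u v in least (λ j → walk? j u v) k p

    d : Vertex → Vertex → ℕ
    d u v = proj₁ (distance u v)

    Wiener : ℕ
    Wiener = sum (map (uncurry d) (pairs vertices))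

    closer : Vertex → Vertex → ℕ
    closer u v = length (filter (λ w → d w u <? d w v) vertices)

    Mostar : ℕ
    Mostar = sum (map (λ (u , v) → ∣ closer u v - closer v u ∣) edges)

B^ : ℕ → Set
B^ n = Vec Bool n

infix 4 _≼_
_≼_ : ∀ {n} → Rel (B^ n) 0ℓ
_≼_ = Pointwise Bool._≤_

Q : ℕ → Graph
Q n = record
  { Vertex   = B^ n
  ; _~_      = λ u v → ∃! _≡_ (λ i → lookup u i ≢ lookup v i)
  ; ~-sym    = λ (i , u≢v , uniq) →
                 i , (λ eq → u≢v (sym eq)) , λ v≢u → uniq (λ eq → v≢u (sym eq))
  ; ~-irrefl = λ (_ , u≢u , _) → u≢u refl
  }

DaisyVertex : ∀ {n} → Pred (B^ n) 0ℓ → Pred (B^ n) 0ℓ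
DaisyVertex X u = ∃[ x ] X x × u ≼ x

record IsometricEmbedding (G H : Graph) : Set where
  private
    module G = Graph G
    module H = Graph H
  field
    to        : G.Vertex → H.Vertex
    injective : Injective _≡_ _≡_ to
    edge      : ∀ {u v} → u G.~ v → to u H.~ to v
    isometric : ∀ u v → ∃[ k ] IsDistance G u v k × IsDistance H (to u) (to v) k

  -- Distances are finite in G, hence G is connected.
  connected : Connected G
  connected u v = let k , (p , _) , _ = isometric u v in k , p

record ProperEmbedding (G : Graph) (n : ℕ) : Set₁ where
  open Graph G
  field
    embedding : IsometricEmbedding G (Q n)
  open IsometricEmbedding embedding public
  field
    X              : Pred (B^ n) 0ℓ
    image-vertices : ∀ x → (∃[ u ] to u ≡ x) ⇔ DaisyVertex X x
    image-edges    : ∀ u v → (u ~ v) ⇔ Graph._~_ (Q n) (to u) (to v)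

module _ {G : Graph} (fin : Finite G) {n : ℕ} (φ : ProperEmbedding G n) where
  open Graph G
  open ProperEmbedding φ

  E : Fin n → List (Vertex × Vertex)
  E i = filter (λ (u , v) → ¬? (lookup (to u) i Bool.≟ lookup (to v) i)) (edges fin)

{-# OPTIONS --safe #-}

-- Let oᵢ and zᵢ count the vertices whose i-th bit is 1 and 0. Distances are
-- Hamming distances, so W(G) = Σ oᵢ zᵢ. A daisy cube is closed under turning a
-- 1 into a 0, so every vertex with i-th bit 1 is the upper end of exactly one
-- edge of direction i: thus |Eᵢ| = oᵢ ≤ zᵢ. An edge of direction i splits the
-- vertices according to their i-th bit and contributes zᵢ − oᵢ to Mo(G).
-- Both formulas follow from |V| = oᵢ + zᵢ and |E| = Σ |Eᵢ|.
module Submission where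

open import Algebra.Properties.CommutativeSemigroup using (interchange)
open import Data.Bool.Base using (Bool; true; false; not; _∧_; b≤b; f≤t)
import Data.Bool.Properties as Bool
open import Data.Fin.Base using (Fin; zero; suc)
import Data.Fin.Properties as Fin
open import Data.List.Base using (List; []; _∷_; _++_; filter; map; sum; length; allFin)
import Data.List.Properties as List
open import Data.List.Membership.Propositional using (_∈_)
open import Data.List.Membership.Propositional.Properties using (∈-allFin)
open import Data.List.Relation.Unary.All as All using (All; []; _∷_)
open import Data.List.Relation.Unary.All.Properties using (all-filter)
open import Data.List.Relation.Unary.AllPairs using ([]; _∷_)
open import Data.List.Relation.Unary.Any using (here; there)
open import Data.List.Relation.Unary.Unique.Propositional using (Unique)
open import Data.List.Relation.Unary.Unique.Propositional.Properties using (allFin⁺)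
open import Data.Nat.Base using (ℕ; _^_)
open import Data.Product using (_×_; _,_; proj₁; proj₂; ∃-syntax; uncurry)
open import Data.Vec.Base using ([]; _∷_; lookup; _[_]≔_)
open import Data.Vec.Properties using (lookup∘update; lookup∘update′)
open import Data.Vec.Relation.Binary.Pointwise.Inductive as Pointwise using ([]; _∷_)
open import Data.Vec.Relation.Binary.Pointwise.Extensional using (ext; Pointwise-≡⇒≡)
open import Function.Base using (_∘_)
open import Function.Bundles using (Equivalence; mk⇔)
open import Level using (0ℓ)
open import Relation.Binary.PropositionalEquality
open import Relation.Nullary using (Dec; does; yes; no; contradiction)
open import Relation.Nullary.Decidable
  using (¬?; _×-dec_; dec-true; dec-false; does-⇔; decidable-stable)
open import Relation.Unary using (Pred; Decidable)
open import Defs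

module _ where
  open import Data.Nat.Base
  open import Data.Nat.Properties

  -- Finite sums over lists and counting by indicators.

  𝟙 : Bool → ℕ
  𝟙 true  = 1
  𝟙 false = 0

  𝟙≤1 : ∀ b → 𝟙 b ≤ 1
  𝟙≤1 true  = ≤-refl
  𝟙≤1 false = z≤n

  𝟙-complement : ∀ b → 𝟙 b + 𝟙 (not b) ≡ 1
  𝟙-complement true  = refl
  𝟙-complement false = refl

  module _ {A : Set} where

    ∑ : List A → (A → ℕ) → ℕ
    ∑ xs f = sum (map f xs)

    syntax ∑ xs (λ x → e) = ∑[ x ∈ xs ] e

    ∑-cong : ∀ {f g} → (∀ x → f x ≡ g x) → ∀ xs → ∑ xs f ≡ ∑ xs g
    ∑-cong f≗g xs = cong sum (List.map-cong f≗g xs)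

    ∑-mono : ∀ {f g} → (∀ x → f x ≤ g x) → ∀ xs → ∑ xs f ≤ ∑ xs g
    ∑-mono f≤g []       = z≤n
    ∑-mono f≤g (x ∷ xs) = +-mono-≤ (f≤g x) (∑-mono f≤g xs)

    ∑-zero : ∀ {f : A → ℕ} {xs} → All (λ x → f x ≡ 0) xs → ∑ xs f ≡ 0
    ∑-zero []       = refl
    ∑-zero (p ∷ ps) = cong₂ _+_ p (∑-zero ps)

    ∑-++ : ∀ xs ys (f : A → ℕ) → ∑ (xs ++ ys) f ≡ ∑ xs f + ∑ ys f
    ∑-++ []       ys f = refl
    ∑-++ (x ∷ xs) ys f = trans (cong (f x +_) (∑-++ xs ys f)) (sym (+-assoc (f x) _ _))

    ∑-+ : ∀ (f g : A → ℕ) xs → ∑[ x ∈ xs ] (f x + g x) ≡ ∑ xs f + ∑ xs g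
    ∑-+ f g []       = refl
    ∑-+ f g (x ∷ xs) = trans (cong (f x + g x +_) (∑-+ f g xs))
                             (interchange +-commutativeSemigroup (f x) _ _ _)

    ∑-*ˡ : ∀ c (f : A → ℕ) xs → ∑[ x ∈ xs ] (c * f x) ≡ c * ∑ xs f
    ∑-*ˡ c f []       = sym (*-zeroʳ c)
    ∑-*ˡ c f (x ∷ xs) = trans (cong (c * f x +_) (∑-*ˡ c f xs)) (sym (*-distribˡ-+ c _ _))

    ∑-*ʳ : ∀ (f : A → ℕ) c xs → ∑[ x ∈ xs ] (f x * c) ≡ ∑ xs f * c
    ∑-*ʳ f c xs = trans (∑-cong (λ x → *-comm (f x) c) xs)
                        (trans (∑-*ˡ c f xs) (*-comm c _))

    length≡∑1 : ∀ (xs : List A) → length xs ≡ ∑[ x ∈ xs ] 1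
    length≡∑1 []       = refl
    length≡∑1 (x ∷ xs) = cong suc (length≡∑1 xs)

    module _ {P : Pred A 0ℓ} (P? : Decidable P) where

      ∑-filter : ∀ (f : A → ℕ) xs →
                 ∑ (filter P? xs) f ≡ ∑[ x ∈ xs ] (𝟙 (does (P? x)) * f x)
      ∑-filter f []       = refl
      ∑-filter f (x ∷ xs) with does (P? x)
      ... | true  = cong₂ _+_ (sym (+-identityʳ (f x))) (∑-filter f xs)
      ... | false = ∑-filter f xs

      ∑-filter-cong : ∀ {f g : A → ℕ} → (∀ x → P x → f x ≡ g x) → ∀ xs →
                      ∑ (filter P? xs) f ≡ ∑ (filter P? xs) g
      ∑-filter-cong f≗g xs =
        cong sum (List.map-cong-local (All.map (f≗g _) (all-filter P? xs)))

      length-filter≡∑ : ∀ xs → length (filter P? xs) ≡ ∑[ x ∈ xs ] 𝟙 (does (P? x))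
      length-filter≡∑ xs =
        trans (length≡∑1 (filter P? xs))
              (trans (∑-filter _ xs) (∑-cong (λ x → *-identityʳ _) xs))

    -- `Unique` makes `x₀` occur exactly once, so the two sums differ in that one term. Adding the
    -- missing values crosswise avoids truncated subtraction.
    ∑-exchange : ∀ {f g : A → ℕ} {xs x₀} → Unique xs → x₀ ∈ xs →
                 (∀ x → x ≢ x₀ → f x ≡ g x) → ∑ xs f + g x₀ ≡ ∑ xs g + f x₀
    ∑-exchange {f} {g} {x ∷ xs} (x∉xs ∷ _) (here refl) f≡g = begin
      f x + ∑ xs f + g x    ≡⟨ cong (λ s → f x + s + g x) tail≡ ⟩
      f x + ∑ xs g + g x    ≡⟨ +-comm _ (g x) ⟩
      g x + (f x + ∑ xs g)  ≡⟨ cong (g x +_) (+-comm (f x) _) ⟩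
      g x + (∑ xs g + f x)  ≡⟨ +-assoc (g x) _ _ ⟨
      g x + ∑ xs g + f x    ∎
      where
      open ≡-Reasoning
      tail≡ : ∑ xs f ≡ ∑ xs g
      tail≡ = cong sum (List.map-cong-local (All.map (λ x≢y → f≡g _ (x≢y ∘ sym)) x∉xs))
    ∑-exchange {f} {g} {x ∷ xs} {x₀} (x∉xs ∷ uniq) (there x₀∈xs) f≡g = begin
      f x + ∑ xs f + g x₀    ≡⟨ +-assoc (f x) _ _ ⟩
      f x + (∑ xs f + g x₀)  ≡⟨ cong₂ _+_ (f≡g x (All.lookup x∉xs x₀∈xs))
                                          (∑-exchange uniq x₀∈xs f≡g) ⟩
      g x + (∑ xs g + f x₀)  ≡⟨ +-assoc (g x) _ _ ⟨
      g x + ∑ xs g + f x₀    ∎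
      where open ≡-Reasoning

    ∑-single : ∀ {f : A → ℕ} {xs x₀} → Unique xs → x₀ ∈ xs →
               (∀ x → x ≢ x₀ → f x ≡ 0) → ∑ xs f ≡ f x₀
    ∑-single {f} {xs} {x₀} uniq x₀∈xs f≡0 = begin
      ∑ xs f                  ≡⟨ +-identityʳ _ ⟨
      ∑ xs f + 0              ≡⟨ ∑-exchange uniq x₀∈xs f≡0 ⟩
      ∑[ x ∈ xs ] 0 + f x₀    ≡⟨ cong (_+ f x₀) (∑-zero (All.universal (λ _ → refl) xs)) ⟩
      f x₀                    ∎
      where open ≡-Reasoning

    module _ {P : Pred A 0ℓ} (P? : Decidable P) where

      count-unique : ∀ {xs x₀} → Unique xs → x₀ ∈ xs → P x₀ → (∀ {x} → P x → x ≡ x₀) →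
                     ∑[ x ∈ xs ] 𝟙 (does (P? x)) ≡ 1
      count-unique uniq x₀∈xs p₀ only =
        trans (∑-single uniq x₀∈xs λ x x≢x₀ → cong 𝟙 (dec-false (P? x) (x≢x₀ ∘ only)))
              (cong 𝟙 (dec-true (P? _) p₀))

      count-≤1 : ∀ {xs} → Unique xs → (∀ {x y} → P x → P y → x ≡ y) →
                 ∑[ x ∈ xs ] 𝟙 (does (P? x)) ≤ 1
      count-≤1 []                          sub = z≤n
      count-≤1 {x ∷ xs} (x∉xs ∷ uniq) sub with P? x
      ... | no _  = count-≤1 uniq sub
      ... | yes p = s≤s (≤-reflexive (∑-zero
        (All.map (λ x≢y → cong 𝟙 (dec-false (P? _) (x≢y ∘ sub p))) x∉xs)))

  ∑-map : {A B : Set} (h : A → B) (f : B → ℕ) (xs : List A) → ∑ (map h xs) f ≡ ∑ xs (f ∘ h)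
  ∑-map h f xs = cong sum (sym (List.map-∘ xs))

  ∑-swap : {A B : Set} (f : A → B → ℕ) (xs : List A) (ys : List B) →
           ∑[ x ∈ xs ] ∑[ y ∈ ys ] f x y ≡ ∑[ y ∈ ys ] ∑[ x ∈ xs ] f x y
  ∑-swap f []       ys = sym (∑-zero (All.universal (λ _ → refl) ys))
  ∑-swap f (x ∷ xs) ys = trans (cong (∑ ys (f x) +_) (∑-swap f xs ys))
                               (sym (∑-+ (f x) _ ys))

  -- The double sum runs over all ordered pairs of positions. Its diagonal vanishes, and the rest is
  -- each pair of positions taken in both orders. This turns sums over unordered pairs into double
  -- sums, which can be factored or counted by rows.
  ∑-pairs : {A : Set} (f : A → A → ℕ) → (∀ x → f x x ≡ 0) → ∀ xs →
            ∑[ p ∈ pairs xs ] (uncurry f p + uncurry (λ x y → f y x) p)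
            ≡ ∑[ x ∈ xs ] ∑[ y ∈ xs ] f x y
  ∑-pairs f f≡0 []       = refl
  ∑-pairs f f≡0 (x ∷ xs) = begin
    ∑ (map (x ,_) xs ++ pairs xs) g
      ≡⟨ ∑-++ (map (x ,_) xs) (pairs xs) g ⟩
    ∑ (map (x ,_) xs) g + ∑ (pairs xs) g
      ≡⟨ cong₂ _+_ (trans (∑-map (x ,_) g xs) (∑-+ (f x) (λ y → f y x) xs))
                   (∑-pairs f f≡0 xs) ⟩
    ∑ xs (f x) + ∑[ y ∈ xs ] f y x + ∑[ u ∈ xs ] ∑ xs (f u)
      ≡⟨ +-assoc (∑ xs (f x)) _ _ ⟩
    ∑ xs (f x) + (∑[ y ∈ xs ] f y x + ∑[ u ∈ xs ] ∑ xs (f u))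
      -- Read from the lower expression up: the row of `x` loses its zero diagonal term, and the
      -- column of `x` is split off from the remaining rows.
      ≡⟨ cong₂ _+_ (cong (_+ ∑ xs (f x)) (f≡0 x)) (∑-+ (λ u → f u x) _ xs) ⟨
    f x x + ∑ xs (f x) + ∑[ u ∈ xs ] (f u x + ∑ xs (f u))
      ∎
    where
    open ≡-Reasoning
    g = λ p → uncurry f p + uncurry (λ x y → f y x) p

  ∑-allFin-suc : ∀ {n} (f : Fin (suc n) → ℕ) →
                 ∑ (allFin (suc n)) f ≡ f zero + ∑ (allFin n) (f ∘ suc)
  ∑-allFin-suc {n} f = cong (λ fs → f zero + sum fs)
    (trans (List.map-tabulate suc f) (sym (List.map-tabulate (λ i → i) (f ∘ suc))))

  -- Differing bits and the Hamming distance.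

  δ : Bool → Bool → ℕ
  δ a b = 𝟙 (does (¬? (a Bool.≟ b)))

  δ-diag : ∀ a → δ a a ≡ 0
  δ-diag true  = refl
  δ-diag false = refl

  δ-≡ : ∀ {a b} → a ≡ b → δ a b ≡ 0
  δ-≡ {a} refl = δ-diag a

  δ-≢ : ∀ {a b} → a ≢ b → δ a b ≡ 1
  δ-≢ {a} {b} a≢b = cong 𝟙 (dec-true (¬? (a Bool.≟ b)) a≢b)

  δ-triangle : ∀ a b c → δ a c ≤ δ a b + δ b c
  δ-triangle true  true  c     = ≤-refl
  δ-triangle false false c     = ≤-refl
  δ-triangle true  false true  = z≤n
  δ-triangle true  false false = ≤-refl
  δ-triangle false true  true  = ≤-refl
  δ-triangle false true  false = z≤n

  -- Two bits differ when one is 1 and the other 0, in one of two orders. In product form, summing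
  -- over all ordered pairs factors into a count of ones times a count of zeros.
  δ-split : ∀ a b → δ a b ≡ 𝟙 a * 𝟙 (not b) + 𝟙 b * 𝟙 (not a)
  δ-split true  true  = refl
  δ-split true  false = refl
  δ-split false true  = refl
  δ-split false false = refl

  module _ {n : ℕ} where

    _~_ = Graph._~_ (Q n)

    hamming : B^ n → B^ n → ℕ
    hamming x y = ∑[ i ∈ allFin n ] δ (lookup x i) (lookup y i)

    lookup-ext : {x y : B^ n} → (∀ i → lookup x i ≡ lookup y i) → x ≡ y
    lookup-ext eq = Pointwise-≡⇒≡ (ext eq)

    -- A second differing coordinate `j` would, like `i`, equal the unique coordinate `k` of the
    -- edge.
    agree-off-direction : ∀ {x y i j} → x ~ y → lookup x i ≢ lookup y i → j ≢ i →
                          lookup x j ≡ lookup y j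
    agree-off-direction {x} {y} {i} {j} (k , _ , uniq) xᵢ≢yᵢ j≢i =
      decidable-stable (lookup x j Bool.≟ lookup y j)
                       (λ xⱼ≢yⱼ → j≢i (trans (sym (uniq xⱼ≢yⱼ)) (uniq xᵢ≢yᵢ)))

    ∑-direction : ∀ {x y i} (f : Fin n → ℕ) → x ~ y → lookup x i ≢ lookup y i →
                  ∑[ j ∈ allFin n ] (δ (lookup x j) (lookup y j) * f j) ≡ f i
    ∑-direction {x} {y} {i} f x~y xᵢ≢yᵢ = trans
      (∑-single (allFin⁺ n) (∈-allFin i) λ j j≢i →
        cong (_* f j) (δ-≡ (agree-off-direction {x} {y} x~y xᵢ≢yᵢ j≢i)))
      (trans (cong (_* f i) (δ-≢ xᵢ≢yᵢ)) (*-identityˡ (f i)))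

    hamming-adjacent : ∀ {x y} → x ~ y → hamming x y ≡ 1
    hamming-adjacent {x} {y} x~y@(i , xᵢ≢yᵢ , _) =
      trans (sym (∑-cong (λ j → *-identityʳ _) (allFin n)))
            (∑-direction {x} {y} (λ _ → 1) x~y xᵢ≢yᵢ)

    hamming-triangle : ∀ x y z → hamming x z ≤ hamming x y + hamming y z
    hamming-triangle x y z =
      ≤-trans (∑-mono (λ i → δ-triangle (lookup x i) (lookup y i) (lookup z i)) (allFin n))
              (≤-reflexive (∑-+ _ _ (allFin n)))

    -- The distances from `z` to the two ends of an edge of direction `i` have equal terms away from
    -- `i`. So bit `i` of `z` alone decides which end is nearer.
    hamming-direction : ∀ {x y i} z → x ~ y → lookup x i ≢ lookup y i →
                        hamming z x + δ (lookup z i) (lookup y i)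
                        ≡ hamming z y + δ (lookup z i) (lookup x i)
    hamming-direction {x} {y} {i} z x~y xᵢ≢yᵢ =
      ∑-exchange (allFin⁺ n) (∈-allFin i) λ j j≢i →
        cong (δ (lookup z j)) (agree-off-direction {x} {y} x~y xᵢ≢yᵢ j≢i)

    -- Each step of a walk changes one coordinate; the triangle inequality adds up these unit
    -- changes.
    hamming≤walk : ∀ {x y k} → Walk (Q n) x y k → hamming x y ≤ k
    hamming≤walk {x} [] = ≤-reflexive
      (∑-zero (All.universal (λ i → δ-diag (lookup x i)) (allFin n)))
    hamming≤walk {x} {z} (_∷_ {v = y} x~y p) =
      ≤-trans (hamming-triangle x y z)
              (+-mono-≤ (≤-reflexive (hamming-adjacent {x} {y} x~y)) (hamming≤walk p))

  -- Walks in the hypercube whose length is the Hamming distance.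

  walk-∷ : ∀ {n a k} {x y : B^ n} → Walk (Q n) x y k → Walk (Q (suc n)) (a ∷ x) (a ∷ y) k
  walk-∷ [] = []
  walk-∷ ((i , xᵢ≢yᵢ , uniq) ∷ p) =
    ( suc i , xᵢ≢yᵢ , λ { {zero}  a≢a   → contradiction refl a≢a
                        ; {suc j} xⱼ≢yⱼ → cong suc (uniq xⱼ≢yⱼ) }) ∷ walk-∷ p

  flip-first : ∀ {n a b} {x : B^ n} → a ≢ b → Graph._~_ (Q (suc n)) (a ∷ x) (b ∷ x)
  flip-first a≢b = zero , a≢b , λ { {zero}  _     → refl
                                  ; {suc j} xⱼ≢xⱼ → contradiction refl xⱼ≢xⱼ }

  -- Flip the differing coordinates one after another, from first to last. With `hamming≤walk`, this
  -- makes the Hamming distance the graph distance of `Q n`.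
  hamming-walk : ∀ {n} (x y : B^ n) → Walk (Q n) x y (hamming x y)
  hamming-walk []      []      = []
  hamming-walk (a ∷ x) (b ∷ y) =
    subst (Walk (Q _) (a ∷ x) (b ∷ y))
          (sym (∑-allFin-suc (λ i → δ (lookup (a ∷ x) i) (lookup (b ∷ y) i))))
          walk
    where
    walk : Walk (Q _) (a ∷ x) (b ∷ y) (δ a b + hamming x y)
    walk with a Bool.≟ b
    ... | yes refl = walk-∷ (hamming-walk x y)
    ... | no a≢b   = flip-first a≢b ∷ walk-∷ (hamming-walk x y)

  -- Turning one coordinate into 0.

  clear-≼ : ∀ {n} (x : B^ n) i → x [ i ]≔ false ≼ x
  clear-≼ (true  ∷ x) zero    = f≤t ∷ Pointwise.refl Bool.≤-refl
  clear-≼ (false ∷ x) zero    = b≤b ∷ Pointwise.refl Bool.≤-refl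
  clear-≼ (a     ∷ x) (suc i) = b≤b ∷ clear-≼ x i

  clear-~ : ∀ {n} (x : B^ n) {i} → lookup x i ≡ true → Graph._~_ (Q n) x (x [ i ]≔ false)
  clear-~ x {i} xᵢ≡1 = i , differ , λ {j} xⱼ≢ → decidable-stable (i Fin.≟ j)
    (λ i≢j → xⱼ≢ (sym (lookup∘update′ (i≢j ∘ sym) x false)))
    where
    differ : lookup x i ≢ lookup (x [ i ]≔ false) i
    differ eq = Bool.not-¬ (trans eq (lookup∘update i x false)) xᵢ≡1

  -- Bit counts and distances in a daisy cube.

  module _ {G : Graph} (fin : Finite G) {n : ℕ} (φ : ProperEmbedding G n) where
    open Graph G using (Vertex) renaming (_~_ to _~ᴳ_; ~-sym to ~ᴳ-sym)
    open Finite fin using (vertices; unique; complete; _~?_)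
    open ProperEmbedding φ

    private
      dist = d fin connected
      dirs = allFin n

    bit : Fin n → Vertex → Bool
    bit i u = lookup (to u) i

    ones zeros : Fin n → ℕ
    ones  i = ∑[ u ∈ vertices ] 𝟙 (bit i u)
    zeros i = ∑[ u ∈ vertices ] 𝟙 (not (bit i u))

    ones+zeros : ∀ i → ones i + zeros i ≡ ∣V∣ fin
    ones+zeros i = begin
      ones i + zeros i                                          ≡⟨ ∑-+ _ _ vertices ⟨
      ∑[ u ∈ vertices ] (𝟙 (bit i u) + 𝟙 (not (bit i u)))      ≡⟨ ∑-cong (λ u → 𝟙-complement (bit i u)) vertices ⟩
      ∑[ u ∈ vertices ] 1                                       ≡⟨ length≡∑1 vertices ⟨
      ∣V∣ fin                                                   ∎
      where open ≡-Reasoning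

    -- The isometry supplies one `k` that is a distance both in `G` and in `Q n`. Minimality
    -- identifies it with `dist` on one side and with the Hamming distance on the other.
    d≡hamming : ∀ u v → dist u v ≡ hamming (to u) (to v)
    d≡hamming u v =
      let k , (p , k-min) , (q , k-min′) = isometric u v
          p′ , min = proj₂ (distance fin connected u v)
      in trans (≤-antisym (min p) (k-min p′))
               (≤-antisym (k-min′ (hamming-walk (to u) (to v))) (hamming≤walk q))

    -- Edges of direction `i`, oriented from bit 1 to bit 0.

    Down : Fin n → Vertex → Vertex → Set
    Down i u v = u ~ᴳ v × bit i u ≡ true × bit i v ≡ false

    down? : ∀ i u v → Dec (Down i u v)
    down? i u v = (u ~? v) ×-dec (bit i u Bool.≟ true) ×-dec (bit i v Bool.≟ false)

    Down⇒≢ : ∀ {i u v} → Down i u v → bit i u ≢ bit i v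
    Down⇒≢ (_ , uᵢ≡1 , vᵢ≡0) uᵢ≡vᵢ = Bool.not-¬ (trans uᵢ≡vᵢ vᵢ≡0) uᵢ≡1

    Down-agree : ∀ {i u v j} → Down i u v → j ≢ i → bit j u ≡ bit j v
    Down-agree {u = u} {v} down j≢i =
      agree-off-direction {x = to u} {to v} (edge (proj₁ down)) (Down⇒≢ {u = u} {v} down) j≢i

    agree⇒≡ : ∀ {i u v} → bit i u ≡ bit i v → (∀ {j} → j ≢ i → bit j u ≡ bit j v) → u ≡ v
    agree⇒≡ {i} {u} {v} at off = injective (lookup-ext agree)
      where
      agree : ∀ j → bit j u ≡ bit j v
      agree j with j Fin.≟ i
      ... | yes refl = at
      ... | no j≢i   = off j≢i

    -- A lower end has bit 0 at `i` and agrees with `u` elsewhere, so its image is determined by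
    -- `u`; the embedding is injective.
    Down-functional : ∀ {i u v v′} → Down i u v → Down i u v′ → v ≡ v′
    Down-functional {u = u} p@(_ , _ , vᵢ≡0) q@(_ , _ , v′ᵢ≡0) =
      agree⇒≡ (trans vᵢ≡0 (sym v′ᵢ≡0))
              (λ j≢i → trans (sym (Down-agree {u = u} p j≢i)) (Down-agree {u = u} q j≢i))

    Down-injective : ∀ {i u u′ v} → Down i u v → Down i u′ v → u ≡ u′
    Down-injective {v = v} p@(_ , uᵢ≡1 , _) q@(_ , u′ᵢ≡1 , _) =
      agree⇒≡ (trans uᵢ≡1 (sym u′ᵢ≡1))
              (λ j≢i → trans (Down-agree {v = v} p j≢i) (sym (Down-agree {v = v} q j≢i)))

    -- The daisy structure enters here: clearing bit `i` stays below the same generator `x`, so the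
    -- result is the image of a vertex `v`. As the image is an induced subgraph, `v` is adjacent to
    -- `u` in `G`.
    Down-exists : ∀ {i} u → bit i u ≡ true → ∃[ v ] Down i u v
    Down-exists {i} u uᵢ≡1 =
      let x , Xx , u≼x = Equivalence.to (image-vertices (to u)) (u , refl)
          v , v≡ = Equivalence.from (image-vertices (to u [ i ]≔ false))
                     (x , Xx , Pointwise.trans Bool.≤-trans (clear-≼ (to u) i) u≼x)
      in v , Equivalence.from (image-edges u v)
               (subst (Graph._~_ (Q n) (to u)) (sym v≡) (clear-~ (to u) uᵢ≡1))
           , uᵢ≡1
           , trans (cong (λ y → lookup y i) v≡) (lookup∘update i (to u) false)

    private
      arcs : Fin n → ℕ
      arcs i = ∑[ u ∈ vertices ] ∑[ v ∈ vertices ] 𝟙 (does (down? i u v))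

    -- Count by upper ends: a vertex with bit 1 has exactly one lower neighbour in direction `i`,
    -- and a vertex with bit 0 has none.
    arcs≡ones : ∀ i → arcs i ≡ ones i
    arcs≡ones i = ∑-cong (λ u → row u (bit i u) refl) vertices
      where
      row : ∀ u b → bit i u ≡ b → ∑[ v ∈ vertices ] 𝟙 (does (down? i u v)) ≡ 𝟙 b
      row u true uᵢ≡1 =
        let v , u↓v = Down-exists u uᵢ≡1 in
        count-unique (down? i u) unique (complete v) u↓v
                     (λ u↓w → Down-functional {u = u} u↓w u↓v)
      row u false uᵢ≡0 = ∑-zero (All.universal
        (λ v → cong 𝟙 (dec-false (down? i u v) λ (_ , uᵢ≡1 , _) → Bool.not-¬ uᵢ≡0 uᵢ≡1)) vertices)

    -- Count the same arcs by lower ends. Turning a 0 into a 1 may leave the daisy cube, so a vertex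
    -- with bit 0 receives at most one arc.
    arcs≤zeros : ∀ i → arcs i ≤ zeros i
    arcs≤zeros i = ≤-trans (≤-reflexive (∑-swap _ vertices vertices))
                           (∑-mono (λ v → column v (bit i v) refl) vertices)
      where
      column : ∀ v b → bit i v ≡ b → ∑[ u ∈ vertices ] 𝟙 (does (down? i u v)) ≤ 𝟙 (not b)
      column v false vᵢ≡0 =
        count-≤1 (λ u → down? i u v) unique (λ p q → Down-injective {v = v} p q)
      column v true vᵢ≡1 = ≤-reflexive (∑-zero (All.universal
        (λ u → cong 𝟙 (dec-false (down? i u v) λ (_ , _ , vᵢ≡0) → Bool.not-¬ vᵢ≡0 vᵢ≡1)) vertices))

    ones≤zeros : ∀ i → ones i ≤ zeros i
    ones≤zeros i = subst (_≤ zeros i) (arcs≡ones i) (arcs≤zeros i)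

    -- Counting edges by direction.

    private
      δᵢ : Fin n → Vertex × Vertex → ℕ
      δᵢ i (u , v) = δ (bit i u) (bit i v)

    ∣Eᵢ∣≡∑δ : ∀ i → length (E fin φ i) ≡ ∑ (edges fin) (δᵢ i)
    ∣Eᵢ∣≡∑δ i = length-filter≡∑ _ (edges fin)

    -- The edge list holds each edge in one unspecified order. An edge of direction `i` is downward
    -- in exactly one of its two orders, so summing over both recovers the count of arcs.
    ∣Eᵢ∣≡ones : ∀ i → length (E fin φ i) ≡ ones i
    ∣Eᵢ∣≡ones i = begin
      length (E fin φ i)
        ≡⟨ ∣Eᵢ∣≡∑δ i ⟩
      ∑ (edges fin) (δᵢ i)
        ≡⟨ ∑-filter (uncurry _~?_) (δᵢ i) (pairs vertices) ⟩
      ∑[ p ∈ pairs vertices ] (𝟙 (does (uncurry _~?_ p)) * δᵢ i p)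
        ≡⟨ ∑-cong orient (pairs vertices) ⟩
      ∑[ p ∈ pairs vertices ] (uncurry f p + uncurry (λ u v → f v u) p)
        ≡⟨ ∑-pairs f f-diag vertices ⟩
      arcs i
        ≡⟨ arcs≡ones i ⟩
      ones i
        ∎
      where
      open ≡-Reasoning
      f : Vertex → Vertex → ℕ
      f u v = 𝟙 (does (down? i u v))

      f-diag : ∀ u → f u u ≡ 0
      f-diag u = cong 𝟙 (dec-false (down? i u u) λ p → Down⇒≢ {u = u} p refl)

      orient-bits : ∀ e a b → 𝟙 e * δ a b ≡
        𝟙 (e ∧ does (a Bool.≟ true) ∧ does (b Bool.≟ false)) +
        𝟙 (e ∧ does (b Bool.≟ true) ∧ does (a Bool.≟ false))
      orient-bits false a     b     = refl
      orient-bits true  true  true  = refl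
      orient-bits true  true  false = refl
      orient-bits true  false true  = refl
      orient-bits true  false false = refl

      orient : ∀ p → 𝟙 (does (uncurry _~?_ p)) * δᵢ i p ≡ uncurry f p + uncurry (λ u v → f v u) p
      orient (u , v) = trans (orient-bits (does (u ~? v)) (bit i u) (bit i v))
        (cong (λ e → f u v + 𝟙 (e ∧ does (bit i v Bool.≟ true) ∧ does (bit i u Bool.≟ false)))
              -- Symmetry of adjacency turns `u ~? v` into the `v ~? u` that the reversed arc tests.
              (does-⇔ (mk⇔ ~ᴳ-sym ~ᴳ-sym) (u ~? v) (v ~? u)))

    ∑-edge-direction : ∀ (f : Fin n → ℕ) u v i → u ~ᴳ v → bit i u ≢ bit i v →
                       ∑[ j ∈ dirs ] (δᵢ j (u , v) * f j) ≡ f i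
    ∑-edge-direction f u v i u~v = ∑-direction {x = to u} {to v} f (edge u~v)

    -- Exchanging the sums charges `f i` once for each edge of direction `i`. Constant weight 1
    -- yields the number of edges, and weight `zeros i ∸ ones i` the Mostar index.
    ∑-edges : ∀ (f : Fin n → ℕ) →
              ∑[ p ∈ edges fin ] ∑[ i ∈ dirs ] (δᵢ i p * f i) ≡ ∑[ i ∈ dirs ] (ones i * f i)
    ∑-edges f = trans (∑-swap _ (edges fin) dirs) (∑-cong direction dirs)
      where
      direction : ∀ i → ∑[ p ∈ edges fin ] (δᵢ i p * f i) ≡ ones i * f i
      direction i = trans (∑-*ʳ (δᵢ i) (f i) (edges fin))
                          (cong (_* f i) (trans (sym (∣Eᵢ∣≡∑δ i)) (∣Eᵢ∣≡ones i)))

    ∣E∣≡∑ones : ∣E∣ fin ≡ ∑[ i ∈ dirs ] (ones i * 1)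
    ∣E∣≡∑ones = begin
      ∣E∣ fin
        ≡⟨ length≡∑1 (edges fin) ⟩
      ∑[ p ∈ edges fin ] 1
        ≡⟨ ∑-filter-cong (uncurry _~?_) one (pairs vertices) ⟩
      ∑[ p ∈ edges fin ] ∑[ i ∈ dirs ] (δᵢ i p * 1)
        ≡⟨ ∑-edges (λ _ → 1) ⟩
      ∑[ i ∈ dirs ] (ones i * 1)
        ∎
      where
      open ≡-Reasoning
      one : ∀ p → uncurry _~ᴳ_ p → 1 ≡ ∑[ i ∈ dirs ] (δᵢ i p * 1)
      one (u , v) u~v = let i , uᵢ≢vᵢ , _ = edge u~v in
        sym (∑-edge-direction (λ _ → 1) u v i u~v uᵢ≢vᵢ)

    -- The Wiener index as a sum over directions.

    Wiener≡ : Wiener fin connected ≡ ∑[ i ∈ dirs ] (ones i * zeros i)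
    Wiener≡ = begin
      ∑ (pairs vertices) (uncurry dist)
        ≡⟨ ∑-cong (λ (u , v) → d≡hamming u v) (pairs vertices) ⟩
      ∑[ p ∈ pairs vertices ] ∑[ i ∈ dirs ] δᵢ i p
        ≡⟨ ∑-swap _ (pairs vertices) dirs ⟩
      ∑[ i ∈ dirs ] ∑ (pairs vertices) (δᵢ i)
        -- Direction `i` contributes the number of vertex pairs that bit `i` separates.
        ≡⟨ ∑-cong cut dirs ⟩
      ∑[ i ∈ dirs ] (ones i * zeros i)
        ∎
      where
      open ≡-Reasoning
      module _ (i : Fin n) where
        f : Vertex → Vertex → ℕ
        f u v = 𝟙 (bit i u) * 𝟙 (not (bit i v))

        f-diag : ∀ b → 𝟙 b * 𝟙 (not b) ≡ 0
        f-diag true  = refl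
        f-diag false = refl

        cut : ∑ (pairs vertices) (δᵢ i) ≡ ones i * zeros i
        cut = begin
          ∑ (pairs vertices) (δᵢ i)
            ≡⟨ ∑-cong (λ (u , v) → δ-split (bit i u) (bit i v)) (pairs vertices) ⟩
          ∑[ p ∈ pairs vertices ] (uncurry f p + uncurry (λ u v → f v u) p)
            ≡⟨ ∑-pairs f (λ u → f-diag (bit i u)) vertices ⟩
          ∑[ u ∈ vertices ] ∑[ v ∈ vertices ] f u v
            ≡⟨ ∑-cong (λ u → ∑-*ˡ (𝟙 (bit i u)) _ vertices) vertices ⟩
          ∑[ u ∈ vertices ] (𝟙 (bit i u) * zeros i)
            ≡⟨ ∑-*ʳ _ (zeros i) vertices ⟩
          ones i * zeros i
            ∎

    -- The two sides of an edge and the Mostar index.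

    closer≡ : ∀ {u v i} → u ~ᴳ v → bit i u ≢ bit i v →
              closer fin connected u v
              ≡ ∑[ w ∈ vertices ] 𝟙 (does (bit i w Bool.≟ bit i u))
    closer≡ {u} {v} {i} u~v uᵢ≢vᵢ =
      trans (length-filter≡∑ _ vertices) (∑-cong (cong 𝟙 ∘ side) vertices)
      where
      balance : ∀ w → dist w u + δ (bit i w) (bit i v) ≡ dist w v + δ (bit i w) (bit i u)
      balance w rewrite d≡hamming w u | d≡hamming w v =
        hamming-direction {x = to u} {to v} (to w) (edge u~v) uᵢ≢vᵢ

      toward : ∀ w → bit i w ≡ bit i u → dist w u < dist w v
      toward w wᵢ≡uᵢ = ≤-reflexive (begin
        suc (dist w u)                      ≡⟨ +-comm 1 _ ⟩
        dist w u + 1                        ≡⟨ cong (dist w u +_) (δ-≢ (uᵢ≢vᵢ ∘ trans (sym wᵢ≡uᵢ))) ⟨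
        dist w u + δ (bit i w) (bit i v)    ≡⟨ balance w ⟩
        dist w v + δ (bit i w) (bit i u)    ≡⟨ cong (dist w v +_) (δ-≡ wᵢ≡uᵢ) ⟩
        dist w v + 0                        ≡⟨ +-identityʳ _ ⟩
        dist w v                            ∎)
        where open ≡-Reasoning

      away : ∀ w → bit i w ≢ bit i u → dist w v ≤ dist w u
      away w wᵢ≢uᵢ = +-cancelʳ-≤ 1 _ _ (begin
        dist w v + 1                        ≡⟨ cong (dist w v +_) (δ-≢ wᵢ≢uᵢ) ⟨
        dist w v + δ (bit i w) (bit i u)    ≡⟨ balance w ⟨
        -- Refuting strict closeness takes only `≤`, so bounding this last term by 1 suffices.
        dist w u + δ (bit i w) (bit i v)    ≤⟨ +-monoʳ-≤ (dist w u) (𝟙≤1 _) ⟩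
        dist w u + 1                        ∎)
        where open ≤-Reasoning

      side : ∀ w → does (dist w u <? dist w v) ≡ does (bit i w Bool.≟ bit i u)
      side w = does-⇔ (mk⇔ (λ lt → decidable-stable (bit i w Bool.≟ bit i u)
                                      (λ wᵢ≢uᵢ → <⇒≱ lt (away w wᵢ≢uᵢ)))
                           (toward w))
                      (dist w u <? dist w v) (bit i w Bool.≟ bit i u)

    -- The two sides of the edge have `ones i` and `zeros i` vertices, in one order or the other;
    -- `ones≤zeros` settles the sign of the difference.
    imbalance : ∀ {u v i} → u ~ᴳ v → bit i u ≢ bit i v →
                ∣ closer fin connected u v - closer fin connected v u ∣ ≡ zeros i ∸ ones i
    imbalance {u} {v} {i} u~v uᵢ≢vᵢ = trans
      (cong₂ ∣_-_∣ (closer≡ u~v uᵢ≢vᵢ) (closer≡ (~ᴳ-sym u~v) (uᵢ≢vᵢ ∘ sym)))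
      (sides (bit i u) (bit i v) uᵢ≢vᵢ)
      where
      side : Bool → ℕ
      side b = ∑[ w ∈ vertices ] 𝟙 (does (bit i w Bool.≟ b))

      side-true : side true ≡ ones i
      side-true = ∑-cong (λ w → lemma (bit i w)) vertices
        where
        lemma : ∀ a → 𝟙 (does (a Bool.≟ true)) ≡ 𝟙 a
        lemma true  = refl
        lemma false = refl

      side-false : side false ≡ zeros i
      side-false = ∑-cong (λ w → lemma (bit i w)) vertices
        where
        lemma : ∀ a → 𝟙 (does (a Bool.≟ false)) ≡ 𝟙 (not a)
        lemma true  = refl
        lemma false = refl

      sides : ∀ a b → a ≢ b → ∣ side a - side b ∣ ≡ zeros i ∸ ones i
      sides true  true  a≢b = contradiction refl a≢b
      sides false false a≢b = contradiction refl a≢b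
      sides true  false _   = trans (cong₂ ∣_-_∣ side-true side-false)
                                    (m≤n⇒∣m-n∣≡n∸m (ones≤zeros i))
      sides false true  _   = trans (∣-∣-comm (side false) (side true))
                                    (sides true false λ ())

    Mostar≡ : Mostar fin connected ≡ ∑[ i ∈ dirs ] (ones i * (zeros i ∸ ones i))
    Mostar≡ = trans (∑-filter-cong (uncurry _~?_) contribution (pairs vertices))
                    (∑-edges (λ i → zeros i ∸ ones i))
      where
      contribution : ∀ p → uncurry _~ᴳ_ p →
        ∣ closer fin connected (proj₁ p) (proj₂ p) - closer fin connected (proj₂ p) (proj₁ p) ∣
        ≡ ∑[ i ∈ dirs ] (δᵢ i p * (zeros i ∸ ones i))
      contribution (u , v) u~v = let i , uᵢ≢vᵢ , _ = edge u~v in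
        trans (imbalance u~v uᵢ≢vᵢ) (sym (∑-edge-direction _ u v i u~v uᵢ≢vᵢ))

    -- Subtraction-free forms of both formulas.

    ∑∣Eᵢ∣² : ℕ
    ∑∣Eᵢ∣² = ∑[ i ∈ dirs ] (length (E fin φ i) ^ 2)

    ∑∣Eᵢ∣²≡ : ∑∣Eᵢ∣² ≡ ∑[ i ∈ dirs ] (ones i * ones i)
    ∑∣Eᵢ∣²≡ = ∑-cong (λ i → trans (cong (_^ 2) (∣Eᵢ∣≡ones i))
                                 (cong (ones i *_) (*-identityʳ (ones i)))) dirs

    ∣V∣∣E∣≡ : ∣V∣ fin * ∣E∣ fin ≡ ∑[ i ∈ dirs ] (ones i * (zeros i + ones i))
    ∣V∣∣E∣≡ = begin
      ∣V∣ fin * ∣E∣ fin                              ≡⟨ cong (∣V∣ fin *_) ∣E∣≡∑ones ⟩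
      ∣V∣ fin * ∑[ i ∈ dirs ] (ones i * 1)           ≡⟨ ∑-*ˡ (∣V∣ fin) _ dirs ⟨
      ∑[ i ∈ dirs ] (∣V∣ fin * (ones i * 1))         ≡⟨ ∑-cong term dirs ⟩
      ∑[ i ∈ dirs ] (ones i * (zeros i + ones i))    ∎
      where
      open ≡-Reasoning
      term : ∀ i → ∣V∣ fin * (ones i * 1) ≡ ones i * (zeros i + ones i)
      term i = begin
        ∣V∣ fin * (ones i * 1)         ≡⟨ cong (∣V∣ fin *_) (*-identityʳ (ones i)) ⟩
        ∣V∣ fin * ones i               ≡⟨ *-comm (∣V∣ fin) (ones i) ⟩
        ones i * ∣V∣ fin               ≡⟨ cong (ones i *_) (ones+zeros i) ⟨
        ones i * (ones i + zeros i)    ≡⟨ cong (ones i *_) (+-comm (ones i) (zeros i)) ⟩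
        ones i * (zeros i + ones i)    ∎

    Wiener+∑∣Eᵢ∣² : Wiener fin connected + ∑∣Eᵢ∣² ≡ ∣V∣ fin * ∣E∣ fin
    Wiener+∑∣Eᵢ∣² = begin
      Wiener fin connected + ∑∣Eᵢ∣²
        ≡⟨ cong₂ _+_ Wiener≡ ∑∣Eᵢ∣²≡ ⟩
      ∑[ i ∈ dirs ] (ones i * zeros i) + ∑[ i ∈ dirs ] (ones i * ones i)
        ≡⟨ ∑-+ _ _ dirs ⟨
      ∑[ i ∈ dirs ] (ones i * zeros i + ones i * ones i)
        ≡⟨ ∑-cong (λ i → *-distribˡ-+ (ones i) _ _) dirs ⟨
      ∑[ i ∈ dirs ] (ones i * (zeros i + ones i))
        ≡⟨ ∣V∣∣E∣≡ ⟨
      ∣V∣ fin * ∣E∣ fin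
        ∎
      where open ≡-Reasoning

    Mostar+∑∣Eᵢ∣² : Mostar fin connected + ∑∣Eᵢ∣² ≡ Wiener fin connected
    Mostar+∑∣Eᵢ∣² = begin
      Mostar fin connected + ∑∣Eᵢ∣²
        ≡⟨ cong₂ _+_ Mostar≡ ∑∣Eᵢ∣²≡ ⟩
      ∑[ i ∈ dirs ] (ones i * (zeros i ∸ ones i)) + ∑[ i ∈ dirs ] (ones i * ones i)
        ≡⟨ ∑-+ _ _ dirs ⟨
      ∑[ i ∈ dirs ] (ones i * (zeros i ∸ ones i) + ones i * ones i)
        ≡⟨ ∑-cong (λ i → *-distribˡ-+ (ones i) _ _) dirs ⟨
      ∑[ i ∈ dirs ] (ones i * (zeros i ∸ ones i + ones i))
        -- The truncated difference is a true one because `ones i` is at most `zeros i`.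
        ≡⟨ ∑-cong (λ i → cong (ones i *_) (m∸n+n≡m (ones≤zeros i))) dirs ⟩
      ∑[ i ∈ dirs ] (ones i * zeros i)
        ≡⟨ Wiener≡ ⟨
      Wiener fin connected
        ∎
      where open ≡-Reasoning

    Mostar+2∑∣Eᵢ∣² : Mostar fin connected + 2 * ∑∣Eᵢ∣² ≡ ∣V∣ fin * ∣E∣ fin
    Mostar+2∑∣Eᵢ∣² = begin
      Mostar fin connected + 2 * ∑∣Eᵢ∣²
        ≡⟨ cong (λ s → Mostar fin connected + (∑∣Eᵢ∣² + s)) (+-identityʳ _) ⟩
      Mostar fin connected + (∑∣Eᵢ∣² + ∑∣Eᵢ∣²)
        ≡⟨ +-assoc (Mostar fin connected) _ _ ⟨
      Mostar fin connected + ∑∣Eᵢ∣² + ∑∣Eᵢ∣²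
        ≡⟨ cong (_+ ∑∣Eᵢ∣²) Mostar+∑∣Eᵢ∣² ⟩
      Wiener fin connected + ∑∣Eᵢ∣²
        ≡⟨ Wiener+∑∣Eᵢ∣² ⟩
      ∣V∣ fin * ∣E∣ fin
        ∎
      where open ≡-Reasoning

-- Passage to integer subtraction.

import Data.Nat.Base as ℕ
import Data.Nat.Properties as ℕ
open import Data.Integer.Base using (+_; _*_; _-_)
import Data.Integer.Properties as ℤ

+≡⇒≡- : ∀ {a b c} → a ℕ.+ b ≡ c → + a ≡ + c - + b
+≡⇒≡- {a} {b} refl = sym (begin
  + (a ℕ.+ b) - + b    ≡⟨ ℤ.[+m]-[+n]≡m⊖n (a ℕ.+ b) b ⟩
  (a ℕ.+ b) ⊖ b        ≡⟨ ℤ.⊖-≥ (ℕ.m≤n+m b a) ⟩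
  + (a ℕ.+ b ℕ.∸ b)    ≡⟨ cong +_ (ℕ.m+n∸n≡m a b) ⟩
  + a                  ∎)
  where
  open ≡-Reasoning
  open import Data.Integer.Base using (_⊖_)

corollary4p1 : (G : Graph) (fin : Finite G) (n : ℕ) (φ : ProperEmbedding G n) →
    let conn = ProperEmbedding.connected φ
        Σ∣Eᵢ∣² = sum (map (λ i → length (E fin φ i) ^ 2) (allFin n)) in
    (+ Wiener fin conn ≡ + ∣V∣ fin * + ∣E∣ fin - + Σ∣Eᵢ∣²)
    × (+ Mostar fin conn ≡ + ∣V∣ fin * + ∣E∣ fin - + 2 * + Σ∣Eᵢ∣²)
corollary4p1 G fin n φ =
    trans (+≡⇒≡- (Wiener+∑∣Eᵢ∣² fin φ))
          (cong (_- + ∑∣Eᵢ∣² fin φ) (ℤ.pos-* (∣V∣ fin) (∣E∣ fin)))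
  , trans (+≡⇒≡- (Mostar+2∑∣Eᵢ∣² fin φ))
          (cong₂ _-_ (ℤ.pos-* (∣V∣ fin) (∣E∣ fin)) (ℤ.pos-* 2 (∑∣Eᵢ∣² fin φ)))
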